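{- Let $T$ be a rooted tree with maximum degree $\Delta$, let $p$ be a positive integer and let $\lambda$ be an integer with $\Delta+p-1\le\lambda\le\min\{\Delta+2p-2,\,2\Delta+p-2\}$. Then both the head level and the neck level of $T$ with respect to $\lambda$ are $O(\min\{\Delta,\ p\log|V(T)|/\log\lambda\})$.
   Context: A $\lambda$-$L(p,1)$-labeling of a graph $G$ is a map $f:V(G)\to\{0,1,\ldots,\lambda\}$ with $|f(x)-f(y)|\ge p$ whenever $x,y$ are adjacent and $|f(x)-f(y)|\ge 1$ whenever $x,y$ are at distance $2$. For integers $h\ge0$ let $L_h=\{h,\ldots,\lambda-h\}$. For $T$ rooted at $v$ and a new vertex $u\notin V(T)$, let $T+(u,v)$ be $T$ with added vertex $u$ and edge $(u,v)$; set $\delta_\lambda((u,v),(a,b))=1$ if $T+(u,v)$ has a $\lambda$-$L(p,1)$-labeling $f$ with $f(u)=a$, $f(v)=b$, and $0$ otherwise. $T$ is $\lambda$-head-$L_h$-compatible if $\delta_\lambda((u,v),(a,b))=\delta_\lambda((u,v),(a',b))$ for all $a,a'\in L_h$, $b\in L_0$ with $|a-b|\ge p$, $|a'-b|\ge p$; $\lambda$-neck-$L_h$-compatible if $\delta_\lambda((u,v),(a,b))=\delta_\lambda((u,v),(a,b'))$ for all $a\in L_0$, $b,b'\in L_h$ with $|a-b|\ge p$, $|a-b'|\ge p$. The neck (resp. head) level with respect to $\lambda$ is $0$ if $T$ is $\lambda$-neck- (resp. head-) $L_0$-compatible, and is $h\ge 1$ if $T$ is not $\lambda$-neck- (resp.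 head-) $L_{h-1}$-compatible but is $\lambda$-neck- (resp. head-) $L_h$-compatible. -}

module Defs where

open import Data.Nat using (ℕ; zero; suc; _+_; _*_; _^_; _≤_; _⊔_; ∣_-_∣)
open import Data.Bool using (Bool; true; false; if_then_else_)
open import Data.Fin using (Fin; zero; suc; inject₁; fromℕ; _≟_)
open import Data.List using (List; map; foldr)
open import Data.Nat.ListAction using (sum)
open import Data.List.Base using (allFin)
open import Data.Product using (Σ; _×_; ∃; ∃-syntax)
open import Relation.Binary.PropositionalEquality using (_≡_; _≢_)
open import Relation.Nullary using (¬_; does)
open import Function.Definitions using (Injective)

Graph : ℕ → Set
Graph n = Fin n → Fin n → Bool

Adj : ∀ {n} → Graph n → Fin n → Fin n → Set
Adj G x y = G x y ≡ true

data Walk {n : ℕ} (G : Graph n) : Fin n → Fin n → Set where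
  here : ∀ {x} → Walk G x x
  step : ∀ {x y z} → Adj G x y → Walk G y z → Walk G x z

HasCycle : ∀ {n} → Graph n → Set
HasCycle {n} G =
  ∃[ k ] Σ (Fin (suc (suc (suc k))) → Fin n) λ c →
    Injective _≡_ _≡_ c
    × (∀ (i : Fin (suc (suc k))) → Adj G (c (inject₁ i)) (c (suc i)))
    × Adj G (c (fromℕ (suc (suc k)))) (c zero)

IsTree : ∀ {n} → Graph n → Set
IsTree {n} G =
  (∀ x y → G x y ≡ G y x)
  × (∀ x → G x x ≡ false)
  × (∀ x y → Walk G x y)
  × ¬ HasCycle G

degree : ∀ {n} → Graph n → Fin n → ℕ
degree {n} G x = sum (map (λ y → if G x y then 1 else 0) (allFin n))

maxDegree : ∀ {n} → Graph n → ℕ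
maxDegree {n} G = foldr _⊔_ 0 (map (degree G) (allFin n))

Dist2 : ∀ {n} → Graph n → Fin n → Fin n → Set
Dist2 G x y = x ≢ y × G x y ≡ false × ∃[ z ] (Adj G x z × Adj G z y)

IsLabeling : (p lam : ℕ) → ∀ {n} → Graph n → (Fin n → ℕ) → Set
IsLabeling p lam {n} G f =
  (∀ x → f x ≤ lam)
  × (∀ x y → Adj G x y → p ≤ ∣ f x - f y ∣)
  × (∀ x y → Dist2 G x y → f x ≢ f y)

-- T + (u,v): new vertex u = zero, old vertex i becomes suc i, new edge u–(suc r).
extend : ∀ {n} → Graph n → Fin n → Graph (suc n)
extend G r zero    zero    = false
extend G r zero    (suc j) = does (j ≟ r)
extend G r (suc i) zero    = does (i ≟ r)
extend G r (suc i) (suc j) = G i j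

Delta : (p lam : ℕ) → ∀ {n} → Graph n → Fin n → ℕ → ℕ → Set
Delta p lam G r a b =
  Σ (Fin _ → ℕ) λ f → IsLabeling p lam (extend G r) f × f zero ≡ a × f (suc r) ≡ b

InL : (lam h a : ℕ) → Set
InL lam h a = h ≤ a × a + h ≤ lam

HeadCompat : (p lam : ℕ) → ∀ {n} → Graph n → Fin n → ℕ → Set
HeadCompat p lam G r h =
  ∀ a a' b → InL lam h a → InL lam h a' → InL lam 0 b →
    p ≤ ∣ a - b ∣ → p ≤ ∣ a' - b ∣ →
    (Delta p lam G r a b → Delta p lam G r a' b) × (Delta p lam G r a' b → Delta p lam G r a b)

NeckCompat : (p lam : ℕ) → ∀ {n} → Graph n → Fin n → ℕ → Set
NeckCompat p lam G r h =
  ∀ a b b' → InL lam 0 a → InL lam h b → InL lam h b' →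
    p ≤ ∣ a - b ∣ → p ≤ ∣ a - b' ∣ →
    (Delta p lam G r a b → Delta p lam G r a b') × (Delta p lam G r a b' → Delta p lam G r a b)

IsHeadLevel : (p lam : ℕ) → ∀ {n} → Graph n → Fin n → ℕ → Set
IsHeadLevel p lam G r zero    = HeadCompat p lam G r 0
IsHeadLevel p lam G r (suc h) = ¬ HeadCompat p lam G r h × HeadCompat p lam G r (suc h)

IsNeckLevel : (p lam : ℕ) → ∀ {n} → Graph n → Fin n → ℕ → Set
IsNeckLevel p lam G r zero    = NeckCompat p lam G r 0
IsNeckLevel p lam G r (suc h) = ¬ NeckCompat p lam G r h × NeckCompat p lam G r (suc h)

-- "h ≤ C · min{Δ, p log n / log λ}" written without reals:
--   h ≤ C·Δ  and  h·log λ ≤ C·p·log n,  i.e.  λ^h ≤ n^(C·p).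
BoundedBy : (C Δ p lam n h : ℕ) → Set
BoundedBy C Δ p lam n h = h ≤ C * Δ × lam ^ h ≤ n ^ (C * p)

{-# OPTIONS --safe #-}

-- Changing a label of the edge (u,v) is propagated from the root downwards: if the labels a, b of the parent of a
-- vertex and of the vertex itself become a', b', then the labels of the children are permuted by an injection
-- carrying the labels compatible with (a,b) to those compatible with (a',b'). Reflection in (b + b') / 2 followed
-- by the transposition that brings the image of a to a' does this, and it moves labels only inside an L_h whose h
-- is about 2p smaller than the one containing the changes above. The loss is harmless in children with a subtree m
-- times smaller than that of their parent; the fewer than m remaining children can instead be sent, by further
-- transpositions, to unused labels deep in the range, provided lam exceeds 2h + m + O(p). So a tree with fewer
-- than m^j vertices is L_h-compatible once h is at least about 2pj. With m ≈ lam / 2 this bounds the level when p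
-- is small against lam; when p is comparable to lam, the bound h ≤ 2Δ is already strong enough, because lam^Δ ≤
-- n^(2 lam).
module Submission where

open import Defs
open import Data.Bool using (true; false; if_then_else_)
import Data.Bool.Properties as Bool
open import Data.Nat
open import Data.Nat.DivMod using (_/_; _%_; m≡m%n+[m/n]*n; m%n<n; m/n*n≤m)
open import Data.Nat.ListAction using (sum)
open import Data.Nat.Properties
open import Data.Nat.Tactic.RingSolver using (solve-∀)
open import Data.Fin using (Fin; zero; suc; toℕ; inject₁; fromℕ)
import Data.Fin.Properties as Fin
open import Data.List using (List; []; _∷_; _++_; length; lookup; filter; map; foldr; upTo; allFin)
open import Data.List.Membership.Propositional using (_∈_; _∉_; lose)
open import Data.List.Membership.Propositional.Properties
  using (∈-map⁺; ∈-map⁻; ∈-++⁺ˡ; ∈-++⁺ʳ; ∈-upTo⁺; ∈-filter⁺; ∈-allFin; ∈-lookup)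
open import Data.List.Membership.DecPropositional _≟_ using (_∈?_)
import Data.List.Membership.DecPropositional as DecMembership
open import Data.List.Properties
  using (length-map; length-++; length-upTo; length-filter; length-tabulate; filter-some)
open import Data.List.Relation.Unary.All using (All; []; _∷_)
import Data.List.Relation.Unary.All as All
import Data.List.Relation.Unary.All.Properties as All
open import Data.List.Relation.Unary.AllPairs using ([]; _∷_)
open import Data.List.Relation.Unary.Any using (Any; here; there; index; any?)
open import Data.List.Relation.Unary.Any.Properties using (lookup-index)
open import Data.List.Relation.Unary.Unique.Propositional using (Unique)
import Data.List.Relation.Unary.Unique.Propositional.Properties as Unique
open import Data.Product using (Σ; _×_; _,_; proj₁; proj₂; ∃-syntax)
open import Data.Sum using (_⊎_; inj₁; inj₂)
open import Function using (_∘_; id)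
open import Relation.Binary.PropositionalEquality
  using (_≡_; _≢_; refl; sym; trans; cong; subst; subst₂)
open import Relation.Nullary using (¬_; Dec; yes; no; does; contradiction; ¬?)
open import Relation.Nullary.Decidable using (_×-dec_; _⊎-dec_; decidable-stable; dec-true)
open import Relation.Unary using (Decidable)

-- Redistributing the labels of the children of one vertex

-- A certificate for linear arithmetic: `L ≤ R` combines the hypotheses and `s` is the slack, so
-- that only a ring identity is left to the solver.
by-combination : ∀ {u v L R} s → L ≤ R → v + L ≡ u + R + s → u ≤ v
by-combination {u} {v} {L} {R} s L≤R eq = +-cancelʳ-≤ R u v (begin
  u + R      ≤⟨ m≤m+n _ s ⟩
  u + R + s  ≡⟨ eq ⟨
  v + L      ≤⟨ +-monoʳ-≤ v L≤R ⟩
  v + R      ∎)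
  where open ≤-Reasoning

Far : ℕ → ℕ → ℕ → Set
Far p x y = x + p ≤ y ⊎ y + p ≤ x

far? : ∀ p x y → Dec (Far p x y)
far? p x y = (x + p ≤? y) ⊎-dec (y + p ≤? x)

far-sym : ∀ {p x y} → Far p x y → Far p y x
far-sym (inj₁ q) = inj₂ q
far-sym (inj₂ q) = inj₁ q

distance⇒far : ∀ {p} x y → p ≤ ∣ x - y ∣ → Far p x y
distance⇒far {p} x y q with ≤-total x y
... | inj₁ x≤y = inj₁ (subst (_≤ y) (+-comm p x)
      (m≤o∸n⇒m+n≤o p x≤y (subst (p ≤_) (m≤n⇒∣m-n∣≡n∸m x≤y) q)))
... | inj₂ y≤x = inj₂ (subst (_≤ x) (+-comm p y)
      (m≤o∸n⇒m+n≤o p y≤x (subst (p ≤_) (m≤n⇒∣n-m∣≡n∸m y≤x) q)))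

far⇒distance : ∀ {p} x y → Far p x y → p ≤ ∣ x - y ∣
far⇒distance {p} x y (inj₁ q) = subst (p ≤_) (sym (m≤n⇒∣m-n∣≡n∸m (m+n≤o⇒m≤o x q)))
  (m+n≤o⇒m≤o∸n p (subst (_≤ y) (+-comm x p) q))
far⇒distance {p} x y (inj₂ q) = subst (p ≤_) (sym (m≤n⇒∣n-m∣≡n∸m (m+n≤o⇒m≤o y q)))
  (m+n≤o⇒m≤o∸n p (subst (_≤ x) (+-comm y p) q))

inL? : ∀ lam h a → Dec (InL lam h a)
inL? lam h a = (h ≤? a) ×-dec (a + h ≤? lam)

inL-anti : ∀ {lam h k a} → h ≤ k → InL lam k a → InL lam h a
inL-anti {a = a} h≤k (k≤a , a+k≤lam) = ≤-trans h≤k k≤a , ≤-trans (+-monoʳ-≤ a h≤k) a+k≤lam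

-- Pigeonhole: if all of `K`, ..., `K + length xs` occurred in `xs`, their positions would inject a
-- set of size `length xs + 1` into one of size `length xs`.
fresh : ∀ K (xs : List ℕ) → ∃[ t ] (K ≤ t × t ≤ K + length xs × t ∉ xs)
fresh K xs with Fin.all? (λ (i : Fin (suc (length xs))) → (K + toℕ i) ∈? xs)
... | yes all∈ = contradiction (Fin.injective⇒≤ index-injective) (n≮n (length xs))
  where
  index-injective : ∀ {i j} → index (all∈ i) ≡ index (all∈ j) → i ≡ j
  index-injective {i} {j} eq = Fin.toℕ-injective (+-cancelˡ-≡ K _ _
    (trans (lookup-index (all∈ i)) (trans (cong (lookup xs) eq) (sym (lookup-index (all∈ j))))))
... | no ¬all∈ with Fin.¬∀⟶∃¬ _ _ (λ i → (K + toℕ i) ∈? xs) ¬all∈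
... | i , i∉ = K + toℕ i , m≤m+n K _ , +-monoʳ-≤ K (s≤s⁻¹ (Fin.toℕ<n i)) , i∉

-- Contains every label closer than `p` to `b`. A superset is enough, so truncation for `b < p` does
-- no harm.
window : ℕ → ℕ → List ℕ
window p b = map ((b ∸ p) +_) (upTo (p + p))

∉window⇒far : ∀ {p b x} → x ∉ window p b → Far p x b
∉window⇒far {p} {b} {x} x∉ = decidable-stable (far? p x b) λ ¬far →
  let x+p>b = ≰⇒> (¬far ∘ inj₁)
      b+p>x = ≰⇒> (¬far ∘ inj₂)
      b∸p≤x = ≤-trans (∸-monoˡ-≤ p (<⇒≤ x+p>b)) (≤-reflexive (m+n∸n≡m x p))
  in x∉ (subst (_∈ window p b) (m+[n∸m]≡n b∸p≤x)
       (∈-map⁺ ((b ∸ p) +_) (∈-upTo⁺ (+-cancelˡ-< (b ∸ p) _ _ (begin-strict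
         b ∸ p + (x ∸ (b ∸ p))  ≡⟨ m+[n∸m]≡n b∸p≤x ⟩
         x                      <⟨ b+p>x ⟩
         b + p                  ≤⟨ +-monoˡ-≤ p (m≤n+m∸n b p) ⟩
         p + (b ∸ p) + p        ≡⟨ rearrange p (b ∸ p) ⟩
         b ∸ p + (p + p)        ∎)))))
  where
  open ≤-Reasoning
  rearrange : ∀ u v → u + v + u ≡ v + (u + u)
  rearrange = solve-∀

swap : ℕ → ℕ → ℕ → ℕ
swap u v x with x ≟ u | x ≟ v
... | yes _ | _     = v
... | no _  | yes _ = u
... | no _  | no _  = x

swap-left : ∀ u v → swap u v u ≡ v
swap-left u v with u ≟ u | u ≟ v
... | yes _  | _ = refl
... | no u≢u | _ = contradiction refl u≢u

swap-right : ∀ u v → swap u v v ≡ u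
swap-right u v with v ≟ u | v ≟ v
... | yes eq | _      = eq
... | no _   | yes _  = refl
... | no _   | no v≢v = contradiction refl v≢v

swap-other : ∀ {u v x} → x ≢ u → x ≢ v → swap u v x ≡ x
swap-other {u} {v} {x} x≢u x≢v with x ≟ u | x ≟ v
... | yes eq | _      = contradiction eq x≢u
... | no _   | yes eq = contradiction eq x≢v
... | no _   | no _   = refl

swap-involutive : ∀ u v x → swap u v (swap u v x) ≡ x
swap-involutive u v x with x ≟ u | x ≟ v
... | yes refl | _        = swap-right u v
... | no _     | yes refl = swap-left u v
... | no x≢u   | no x≢v   = swap-other x≢u x≢v

-- Moves and permutations of labels

module Relabelling (p lam : ℕ) where

  -- The target of a change lies `p` deeper than its source has to, so that all labels closer than
  -- `p` to the target are still in `L_k`.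
  Move : ℕ → ℕ → ℕ → Set
  Move k x x' = x' ≡ x ⊎ (InL lam k x × InL lam (k + p) x')

  move? : ∀ k x x' → Dec (Move k x x')
  move? k x x' = (x' ≟ x) ⊎-dec (inL? lam k x ×-dec inL? lam (k + p) x')

  move-anti : ∀ {h k x x'} → h ≤ k → Move k x x' → Move h x x'
  move-anti h≤k (inj₁ eq)      = inj₁ eq
  move-anti h≤k (inj₂ (q , q')) = inj₂ (inL-anti h≤k q , inL-anti (+-monoˡ-≤ p h≤k) q')

  move-bound : ∀ {k x x'} → x ≤ lam → Move k x x' → x' ≤ lam
  move-bound x≤ (inj₁ refl)          = x≤
  move-bound x≤ (inj₂ (_ , _ , q)) = m+n≤o⇒m≤o _ q

  -- Unlike `Move`, an equivalence relation, hence stable under composing permutations.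
  Within : ℕ → ℕ → ℕ → Set
  Within s x y = x ≡ y ⊎ (InL lam s x × InL lam s y)

  within-refl : ∀ {s x} → Within s x x
  within-refl = inj₁ refl

  within-sym : ∀ {s x y} → Within s x y → Within s y x
  within-sym (inj₁ eq)      = inj₁ (sym eq)
  within-sym (inj₂ (q , r)) = inj₂ (r , q)

  within-trans : ∀ {s x y z} → Within s x y → Within s y z → Within s x z
  within-trans (inj₁ refl)    w               = w
  within-trans w              (inj₁ refl)     = w
  within-trans (inj₂ (q , _)) (inj₂ (_ , r)) = inj₂ (q , r)

  move⇒within : ∀ {s k x x'} → s ≤ k → Move k x x' → Within s x x'
  move⇒within s≤k (inj₁ refl)     = inj₁ refl
  move⇒within s≤k (inj₂ (q , q')) = inj₂ (inL-anti s≤k q , inL-anti (≤-trans s≤k (m≤m+n _ p)) q')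

  within⇒move : ∀ {k x x'} → Within (k + p) x x' → Move k x x'
  within⇒move (inj₁ refl)     = inj₁ refl
  within⇒move (inj₂ (q , q')) = inj₂ (inL-anti (m≤m+n _ p) q , q')

  swap-within : ∀ {s u v} → Within s u v → ∀ x → Within s x (swap u v x)
  swap-within {u = u} {v} w x with x ≟ u | x ≟ v
  ... | yes refl | _        = w
  ... | no _     | yes refl = within-sym w
  ... | no _     | no _     = within-refl

  -- Each step costs `p` because a reflection reaches up to `p` beyond the two reflected labels, and
  -- another `p` because the target of a `Move` must lie that much deeper.
  threshold : ℕ → ℕ
  threshold zero    = 0
  threshold (suc i) = threshold i + p + p

  threshold-mono : ∀ {i j} → i ≤ j → threshold i ≤ threshold j
  threshold-mono z≤n       = z≤n
  threshold-mono (s≤s i≤j) = +-monoˡ-≤ p (+-monoˡ-≤ p (threshold-mono i≤j))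

  record Shift (s b b' : ℕ) (σ : ℕ → ℕ) : Set where
    field
      injective : ∀ {x y} → σ x ≡ σ y → x ≡ y
      within    : ∀ x → Within s x (σ x)
      far       : ∀ x → Far p x b → Far p (σ x) b'

  -- The open interval from `lo - p` to `hi + p`. It is symmetric about the midpoint of `lo` and
  -- `hi`, and labels outside it are far from every label between `lo` and `hi`.
  Inside : ℕ → ℕ → ℕ → Set
  Inside lo hi x = lo < x + p × x < hi + p

  inside? : ∀ lo hi x → Dec (Inside lo hi x)
  inside? lo hi x = (lo <? x + p) ×-dec (x <? hi + p)

  reflect : ℕ → ℕ → ℕ → ℕ
  reflect lo hi x with inside? lo hi x
  ... | yes _ = lo + hi ∸ x
  ... | no _  = x

  -- The bound `p ≤ lo` gives `hi + p ≤ lo + hi`, so the subtraction in `reflect` never truncates.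
  module Reflection {lo hi : ℕ} (lo≤hi : lo ≤ hi) (p≤lo : p ≤ lo) where

    inside⇒≤ : ∀ {x} → Inside lo hi x → x ≤ lo + hi
    inside⇒≤ {x} (_ , x<) = begin
      x        ≤⟨ <⇒≤ x< ⟩
      hi + p   ≤⟨ +-monoʳ-≤ hi p≤lo ⟩
      hi + lo  ≡⟨ +-comm hi lo ⟩
      lo + hi  ∎
      where open ≤-Reasoning

    inside-complement : ∀ {x y} → x + y ≡ lo + hi → Inside lo hi x → Inside lo hi y
    inside-complement {x} {y} eq (lo< , x<) =
        by-combination 0 (+-mono-≤ (≤-reflexive (sym eq)) x<) (i lo hi x y p)
      , by-combination 0 (+-mono-≤ (≤-reflexive eq) lo<) (j lo hi x y p)
      where
      i : ∀ lo hi x y p → y + p + (lo + hi + suc x) ≡ suc lo + (x + y + (hi + p)) + 0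
      i = solve-∀
      j : ∀ lo hi x y p → hi + p + (x + y + suc lo) ≡ suc y + (lo + hi + (x + p)) + 0
      j = solve-∀

    reflect-inside : ∀ {x} → Inside lo hi x → x + reflect lo hi x ≡ lo + hi
    reflect-inside {x} q with inside? lo hi x
    ... | yes _ = m+[n∸m]≡n (inside⇒≤ q)
    ... | no ¬q = contradiction q ¬q

    reflect-outside : ∀ {x} → ¬ Inside lo hi x → reflect lo hi x ≡ x
    reflect-outside {x} ¬q with inside? lo hi x
    ... | yes q = contradiction q ¬q
    ... | no _  = refl

    reflect-involutive : ∀ x → reflect lo hi (reflect lo hi x) ≡ x
    reflect-involutive x with inside? lo hi x
    ... | no ¬q = reflect-outside ¬q
    ... | yes q = +-cancelˡ-≡ (lo + hi ∸ x) _ _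
          (trans (reflect-inside (inside-complement eq q)) (trans (sym eq) (+-comm x _)))
      where eq = m+[n∸m]≡n (inside⇒≤ q)

    reflect-injective : ∀ {x y} → reflect lo hi x ≡ reflect lo hi y → x ≡ y
    reflect-injective {x} {y} eq =
      trans (sym (reflect-involutive x)) (trans (cong (reflect lo hi) eq) (reflect-involutive y))

    complement-far : ∀ {x y} c c' → x + y ≡ lo + hi → c + c' ≡ lo + hi → Far p x c → Far p y c'
    complement-far {x} {y} c c' eq eq' (inj₁ q) =
      inj₂ (by-combination 0 (+-mono-≤ (≤-reflexive (trans eq' (sym eq))) q) (i x y c c' p))
      where
      i : ∀ x y c c' p → y + (c + c' + (x + p)) ≡ c' + p + (x + y + c) + 0
      i = solve-∀
    complement-far {x} {y} c c' eq eq' (inj₂ q) =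
      inj₁ (by-combination 0 (+-mono-≤ (≤-reflexive (trans eq (sym eq'))) q) (i x y c c' p))
      where
      i : ∀ x y c c' p → c' + (x + y + (c + p)) ≡ y + p + (c + c' + x) + 0
      i = solve-∀

    outside⇒far : ∀ {x c} → ¬ Inside lo hi x → lo ≤ c → c ≤ hi → Far p x c
    outside⇒far {x} {c} ¬q lo≤c c≤hi with lo <? x + p | x <? hi + p
    ... | yes q | yes q' = contradiction (q , q') ¬q
    ... | no q  | _      = inj₁ (≤-trans (≮⇒≥ q) lo≤c)
    ... | yes _ | no q'  = inj₂ (≤-trans (+-monoˡ-≤ p c≤hi) (≮⇒≥ q'))

    -- Inside the interval the reflection preserves distances and carries `c` to `c'`; a label fixed
    -- outside it is far from `c'` in any case.
    reflect-far : ∀ {c c'} → c + c' ≡ lo + hi → lo ≤ c' → c' ≤ hi →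
      ∀ x → Far p x c → Far p (reflect lo hi x) c'
    reflect-far {c} {c'} eq lo≤c' c'≤hi x far with inside? lo hi x
    ... | yes q = complement-far c c' (m+[n∸m]≡n (inside⇒≤ q)) eq far
    ... | no ¬q = outside⇒far ¬q lo≤c' c'≤hi

    inside⇒inL : ∀ {s} → InL lam (s + p) lo → InL lam (s + p) hi →
      ∀ {x} → Inside lo hi x → InL lam s x
    inside⇒inL {s} (q , _) (_ , r) {x} (lo< , x<) =
        +-cancelʳ-≤ p s x (≤-trans q (<⇒≤ lo<))
      , (begin
          x + s         ≤⟨ +-monoˡ-≤ s (<⇒≤ x<) ⟩
          hi + p + s    ≡⟨ +-assoc hi p s ⟩
          hi + (p + s)  ≡⟨ cong (hi +_) (+-comm p s) ⟩
          hi + (s + p)  ≤⟨ r ⟩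
          lam           ∎)
      where open ≤-Reasoning

    reflect-within : ∀ {s} → InL lam (s + p) lo → InL lam (s + p) hi →
      ∀ x → Within s x (reflect lo hi x)
    reflect-within lo∈ hi∈ x with inside? lo hi x
    ... | yes q = inj₂ (inside⇒inL lo∈ hi∈ q ,
            inside⇒inL lo∈ hi∈ (inside-complement (m+[n∸m]≡n (inside⇒≤ q)) q))
    ... | no _  = within-refl

  shift : ∀ {s} b b' → Move (s + p) b b' → ∃[ ρ ] Shift s b b' ρ
  shift b b' (inj₁ refl) = id , record
    { injective = id ; within = λ _ → within-refl ; far = λ _ → id }
  shift {s} b b' (inj₂ (b∈ , b'∈)) with inL-anti (m≤m+n (s + p) p) b'∈ | ≤-total b b'
  ... | b'∈ₛ | inj₁ b≤b' = reflect b b' , record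
    { injective = reflect-injective
    ; within    = reflect-within b∈ b'∈ₛ
    ; far       = reflect-far refl b≤b' ≤-refl }
    where open Reflection b≤b' (≤-trans (m≤n+m p s) (proj₁ b∈))
  ... | b'∈ₛ | inj₂ b'≤b = reflect b' b , record
    { injective = reflect-injective
    ; within    = reflect-within b'∈ₛ b∈
    ; far       = reflect-far (+-comm b b') ≤-refl b'≤b }
    where open Reflection b'≤b (≤-trans (m≤n+m p s) (proj₁ b'∈ₛ))

  -- The constraints from above on a child's label, when its parent has label `b` and its
  -- grandparent label `a`.
  Allowed : ℕ → ℕ → ℕ → Set
  Allowed a b c = Far p c b × c ≢ a

  allowed? : ∀ a b c → Dec (Allowed a b c)
  allowed? a b c = far? p c b ×-dec ¬? (c ≟ a)

  record Adjust (s a b a' b' : ℕ) (σ : ℕ → ℕ) : Set where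
    field
      injective : ∀ {x y} → σ x ≡ σ y → x ≡ y
      within    : ∀ x → Within s x (σ x)
      allowed   : ∀ {c} → Allowed a b c → Allowed a' b' (σ c)

  adjust-swap : ∀ {s a b a' b' σ u v} → Adjust s a b a' b' σ → Within s u v →
    Allowed a' b' u → Allowed a' b' v → Adjust s a b a' b' (swap u v ∘ σ)
  adjust-swap {s} {a} {b} {a'} {b'} {σ} {u} {v} adj w au av = record
    { injective = λ {x} {y} eq → injective
        (trans (sym (swap-involutive u v (σ x))) (trans (cong (swap u v) eq) (swap-involutive u v (σ y))))
    ; within    = λ x → within-trans (within x) (swap-within w (σ x))
    ; allowed   = λ al → keeps (allowed al) }
    where
    open Adjust adj
    keeps : ∀ {x} → Allowed a' b' x → Allowed a' b' (swap u v x)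
    keeps {x} ax with x ≟ u | x ≟ v
    ... | yes _ | _     = av
    ... | no _  | yes _ = au
    ... | no _  | no _  = ax

  -- After the shift `ρ` the label to be avoided is `ρ a` instead of `a'`, and the transposition of
  -- these two corrects this. A label sent to `a'` by `ρ` ends at `ρ a`, which is far from `b'`
  -- because `a` is far from `b`.
  adjust : ∀ {s} a b a' b' → Move (s + p) a a' → Move (s + p) b b' → Far p a b → Far p a' b' →
    ∃[ σ ] Adjust s a b a' b' σ
  adjust {s} a b a' b' ma mb fa fa' with shift {s} b b' mb
  ... | ρ , sh = swap (ρ a) a' ∘ ρ , record
    { injective = λ {x} {y} eq → injective
        (trans (sym (swap-involutive (ρ a) a' (ρ x))) (trans (cong (swap (ρ a) a') eq) (swap-involutive (ρ a) a' (ρ y))))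
    ; within    = λ x → within-trans (within x) (swap-within wa (ρ x))
    ; allowed   = λ {c} (fc , c≢a) → keeps (far c fc) (c≢a ∘ injective) }
    where
    open Shift sh
    wa : Within s (ρ a) a'
    wa = within-trans (within-sym (within a)) (move⇒within (m≤m+n s p) ma)
    keeps : ∀ {x} → Far p x b' → x ≢ ρ a → Allowed a' b' (swap (ρ a) a' x)
    keeps {x} fx x≢ρa with x ≟ ρ a | x ≟ a'
    ... | yes eq | _        = contradiction eq x≢ρa
    ... | no _   | yes refl = far a fa , x≢ρa ∘ sym
    ... | no _   | no x≢a'  = fx , x≢a'

  -- A forbidden label is a' or close to b', and moves only happen when a' and b' lie deep in the label range.
  forbidden⇒inL : ∀ {k a b a' b'} → p ≤ k → Move k a a' → Move k b b' →
    ∀ {c} → Allowed a b c → ¬ Allowed a' b' c → InL lam k c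
  forbidden⇒inL {k} {a} {b} {a'} {b'} p≤k ma mb {c} (fc , c≢a) ¬al with far? p c b' | c ≟ a'
  ... | yes f | no c≢a' = contradiction (f , c≢a') ¬al
  ... | yes _ | yes refl = from ma
    where
    from : Move k a c → InL lam k c
    from (inj₁ eq)      = contradiction eq c≢a
    from (inj₂ (_ , q)) = inL-anti (m≤m+n k p) q
  ... | no ¬f | _ = from mb
    where
    from : Move k b b' → InL lam k c
    from (inj₁ refl)      = contradiction fc ¬f
    from (inj₂ (_ , b'∈)) = inside⇒inL b'∈ b'∈ (≰⇒> (¬f ∘ inj₁) , ≰⇒> (¬f ∘ inj₂))
      where open Reflection {b'} ≤-refl (≤-trans p≤k (≤-trans (m≤m+n k p) (proj₁ b'∈)))

  fresh-allowed : ∀ K a' b' M → K + (1 + (p + p) + M) + K ≤ lam →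
    (xs : List ℕ) → length xs ≤ M → ∃[ t ] (InL lam K t × Allowed a' b' t × t ∉ xs)
  fresh-allowed K a' b' M bound xs len≤M with fresh K (a' ∷ window p b' ++ xs)
  ... | t , K≤t , t≤ , t∉ = t
      , (K≤t , ≤-trans (+-monoˡ-≤ K (≤-trans t≤ (+-monoʳ-≤ K len))) bound)
      , (∉window⇒far (t∉ ∘ there ∘ ∈-++⁺ˡ) , t∉ ∘ here)
      , t∉ ∘ there ∘ ∈-++⁺ʳ (window p b')
    where
    len : length (a' ∷ window p b' ++ xs) ≤ 1 + (p + p) + M
    len = begin
      suc (length (window p b' ++ xs))        ≡⟨ cong suc (length-++ (window p b')) ⟩
      suc (length (window p b') + length xs)  ≡⟨ cong (λ l → suc (l + length xs))
                                                   (trans (length-map _ (upTo (p + p))) (length-upTo (p + p))) ⟩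
      suc (p + p + length xs)                 ≤⟨ +-monoʳ-≤ (suc (p + p)) len≤M ⟩
      1 + (p + p) + M                         ∎
      where open ≤-Reasoning

  -- The permutation from `adjust` controls all labels at depth `s`. The listed labels are to
  -- satisfy the stronger `Move k`, and are retargeted one at a time by transpositions that leave
  -- the images of those already treated in place.
  redistribute : ∀ {s} a b a' b' → let k = s + p in
    Move k a a' → Move k b b' → Far p a b → Far p a' b' →
    ∀ M → (k + p) + (1 + (p + p) + M) + (k + p) ≤ lam →
    (cs : List ℕ) → All (Allowed a b) cs → length cs ≤ M →
    ∃[ σ ] (Adjust s a b a' b' σ × All (λ c → Move k c (σ c)) cs)
  redistribute {s} a b a' b' ma mb fa fa' M bound [] [] _ with adjust {s} a b a' b' ma mb fa fa'
  ... | σ , adj = σ , adj , []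
  redistribute {s} a b a' b' ma mb fa fa' M bound (c ∷ cs) (ac ∷ acs) len
    with redistribute {s} a b a' b' ma mb fa fa' M bound cs acs (≤-trans (n≤1+n _) len)
  ... | σ , adj , mcs with c ∈? cs
  ... | yes c∈ = σ , adj , All.lookup mcs c∈ ∷ mcs
  ... | no c∉ = retarget target
    where
    k = s + p
    open Adjust adj

    Target : ℕ → Set
    Target t = Move k c t × Allowed a' b' t × t ∉ map σ cs

    replacement : InL lam k c → Σ ℕ Target
    replacement c∈ with fresh-allowed (k + p) a' b' M bound (map σ cs)
      (≤-trans (≤-reflexive (length-map σ cs)) (≤-trans (n≤1+n _) len))
    ... | t , t∈ , at , t∉ = t , inj₂ (c∈ , t∈) , at , t∉

    target : Σ ℕ Target
    -- The label `c` stays put if it can, since outside `L_k` it may not move. Otherwise it is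
    -- forbidden, or it is the image of another listed label `d` that really moved; either way it
    -- lies in `L_k` and a fresh deep label replaces it.
    target with allowed? a' b' c | c ∈? map σ cs
    ... | yes al | no c∉σcs = c , inj₁ refl , al , c∉σcs
    ... | no ¬al | _ = replacement (forbidden⇒inL (m≤n+m p s) ma mb ac ¬al)
    ... | yes _ | yes c∈σcs with ∈-map⁻ σ c∈σcs
    ... | d , d∈ , c≡σd with All.lookup mcs d∈
    ... | inj₁ σd≡d = contradiction (subst (_∈ cs) (sym (trans c≡σd σd≡d)) d∈) c∉
    ... | inj₂ (_ , σd∈) = replacement (subst (InL lam k) (sym c≡σd) (inL-anti (m≤m+n k p) σd∈))

    retarget : Σ ℕ Target → ∃[ τ ] (Adjust s a b a' b' τ × All (λ c → Move k c (τ c)) (c ∷ cs))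
    retarget (t , mt , at , t∉) = swap (σ c) t ∘ σ
      , adjust-swap adj (within-trans (within-sym (within c)) (move⇒within (m≤m+n s p) mt)) (allowed ac) at
      , subst (Move k c) (sym (swap-left (σ c) t)) mt ∷ All.tabulate λ {d} d∈ →
          subst (Move k d) (sym (swap-other
            (λ eq → c∉ (subst (_∈ cs) (injective eq) d∈))
            (λ eq → t∉ (subst (_∈ map σ cs) eq (∈-map⁺ σ d∈)))))
            (All.lookup mcs d∈)

-- Parent and depth in a tree

least : ∀ {P : ℕ → Set} → (∀ n → Dec (P n)) → ∀ n → P n → ∃[ m ] (P m × (∀ k → k < m → ¬ P k))
least P? zero p = 0 , p , λ _ ()
least P? (suc n) p with P? 0
... | yes p₀ = 0 , p₀ , λ _ ()
... | no ¬p₀ with least (P? ∘ suc) n p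
... | m , pm , minimal = suc m , pm , λ { zero _ → ¬p₀ ; (suc k) (s≤s k<m) → minimal k k<m }

-- The parent of the root is a dummy value: `Child` also compares depths, which excludes the root as
-- a child.
record Rooted {N : ℕ} (G : Graph N) (root : Fin N) : Set where
  field
    parent  : Fin N → Fin N
    depth   : Fin N → ℕ

  Child : Fin N → Fin N → Set
  Child x y = parent y ≡ x × depth y ≡ suc (depth x)

  field
    adj⇒child    : ∀ {x y} → Adj G x y → Child x y ⊎ Child y x
    child⇒adj    : ∀ {x y} → Child x y → Adj G x y
    adj-sym      : ∀ {x y} → Adj G x y → Adj G y x
    parent-child : ∀ {y k} → depth y ≡ suc k → Child (parent y) y
    depth-root   : depth root ≡ 0
    depth-zero   : ∀ {x} → depth x ≡ 0 → x ≡ root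

lookup-injective : ∀ {A : Set} {xs : List A} → Unique xs → ∀ {i j} → lookup xs i ≡ lookup xs j → i ≡ j
lookup-injective (_ ∷ _) {zero} {zero} eq = refl
lookup-injective {xs = x ∷ xs} (x≢ ∷ u) {zero} {suc j} eq = contradiction eq (All.lookup x≢ (∈-lookup j))
lookup-injective {xs = x ∷ xs} (x≢ ∷ u) {suc i} {zero} eq = contradiction (sym eq) (All.lookup x≢ (∈-lookup i))
lookup-injective (_ ∷ u) {suc i} {suc j} eq = cong suc (lookup-injective u eq)

-- Simple paths and cycles

module Paths {N : ℕ} (G : Graph N) where

  data Detour (z : Fin N) : Fin N → Fin N → Set where
    stop : ∀ {x} → x ≢ z → Detour z x x
    go   : ∀ {x y w} → x ≢ z → Adj G x y → Detour z y w → Detour z x w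

  detour-trans : ∀ {z x y w} → Detour z x y → Detour z y w → Detour z x w
  detour-trans (stop _)     e = e
  detour-trans (go x≢z a d) e = go x≢z a (detour-trans d e)

  detour-sym : (∀ {x y} → Adj G x y → Adj G y x) → ∀ {z x y} → Detour z x y → Detour z y x
  detour-sym s (stop x≢z)             = stop x≢z
  detour-sym s (go x≢z a d@(stop y≢z))   = go y≢z (s a) (stop x≢z)
  detour-sym s (go x≢z a d@(go y≢z _ _)) = detour-trans (detour-sym s d) (go y≢z (s a) (stop x≢z))

  data Chain : Fin N → Fin N → List (Fin N) → Set where
    end  : ∀ {x} → Chain x x (x ∷ [])
    link : ∀ {x y w xs} → Adj G x y → Chain y w xs → Chain x w (x ∷ xs)

  chain-consecutive : ∀ {x y v vs} → Chain x y (v ∷ vs) → ∀ (i : Fin (length vs)) →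
    Adj G (lookup (v ∷ vs) (inject₁ i)) (lookup (v ∷ vs) (suc i))
  chain-consecutive (link a end)        zero    = a
  chain-consecutive (link a (link _ _)) zero    = a
  chain-consecutive (link _ c@(link _ _)) (suc i) = chain-consecutive c i

  chain-last : ∀ {x y v vs} → Chain x y (v ∷ vs) → lookup (v ∷ vs) (fromℕ (length vs)) ≡ y
  chain-last end                 = refl
  chain-last (link _ end)        = refl
  chain-last (link _ c@(link _ _)) = chain-last c

  SimplePath : Fin N → Fin N → Fin N → Set
  SimplePath z x y = ∃[ xs ] (Chain x y xs × Unique xs × All (z ≢_) xs)

  truncate : ∀ {z w x y xs} → Chain x y xs → Unique xs → All (z ≢_) xs → w ∈ xs → SimplePath z w y
  truncate c@end        u          a       (here refl) = _ , c , u , a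
  truncate c@(link _ _) u          a       (here refl) = _ , c , u , a
  truncate (link _ c)   (_ ∷ u) (_ ∷ a) (there w∈)  = truncate c u a w∈

  loop-erasure : ∀ {z x y} → Detour z x y → SimplePath z x y
  loop-erasure (stop x≢z) = _ , end , ([] ∷ []) , (x≢z ∘ sym ∷ [])
  loop-erasure {x = x} (go x≢z a d) with loop-erasure d
  ... | xs , c , u , z≢ with DecMembership._∈?_ Fin._≟_ x xs
  ... | yes x∈ = truncate c u z≢ x∈
  ... | no x∉  = x ∷ xs , link a c , All.¬Any⇒All¬ xs x∉ ∷ u , x≢z ∘ sym ∷ z≢

  -- Loop erasure makes the detour simple, and `z` closes it up; `x ≢ y` guarantees at least three
  -- vertices.
  detour⇒cycle : ∀ {z x y} → x ≢ y → Adj G z x → Adj G y z → Detour z x y → HasCycle G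
  detour⇒cycle {z} x≢y zx yz d with loop-erasure d
  ... | _ , end , _ = contradiction refl x≢y
  ... | x ∷ w ∷ ws , c@(link _ _) , u , z≢ = length ws , lookup (z ∷ x ∷ w ∷ ws)
      , lookup-injective (z≢ ∷ u)
      , chain-consecutive (link zx c)
      , subst (λ v → Adj G v z) (sym (chain-last (link zx c))) yz

-- Breadth-first distances from the root

module BreadthFirst {n : ℕ} (G : Graph n) (r : Fin n) (tree : IsTree G) where
  open Paths G

  adj-symmetric : ∀ {x y} → Adj G x y → Adj G y x
  adj-symmetric {x} {y} a = trans (proj₁ tree y x) a

  adj-irreflexive : ∀ {x} → ¬ Adj G x x
  adj-irreflexive {x} a with trans (sym (proj₁ (proj₂ tree) x)) a
  ... | ()

  -- Walks of length exactly `k`: decidable by recursion, so the least such `k` can be searched for.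
  Reach : ℕ → Fin n → Set
  Reach zero    x = x ≡ r
  Reach (suc k) x = ∃[ y ] (Adj G y x × Reach k y)

  reach? : ∀ k x → Dec (Reach k x)
  reach? zero    x = x Fin.≟ r
  reach? (suc k) x = Fin.any? λ y → (G y x Bool.≟ true) ×-dec reach? k y

  walk⇒reach : ∀ {k x y} → Reach k x → Walk G x y → ∃[ l ] Reach l y
  walk⇒reach ρ here       = _ , ρ
  walk⇒reach ρ (step a w) = walk⇒reach (_ , a , ρ) w

  distance : ∀ x → ∃[ k ] (Reach k x × (∀ l → l < k → ¬ Reach l x))
  distance x with walk⇒reach {0} refl (proj₁ (proj₂ (proj₂ tree)) r x)
  ... | l , ρ = least (λ k → reach? k x) l ρ

  dist : Fin n → ℕ
  dist x = proj₁ (distance x)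

  dist-least : ∀ {k x} → Reach k x → dist x ≤ k
  dist-least {k} {x} ρ = ≮⇒≥ λ k< → proj₂ (proj₂ (distance x)) k k< ρ

  dist-adj : ∀ {x y} → Adj G x y → dist y ≤ suc (dist x)
  dist-adj {x} a = dist-least (x , a , proj₁ (proj₂ (distance x)))

  predecessor : ∀ {k x} → dist x ≡ suc k → ∃[ y ] (Adj G y x × dist y ≡ k)
  predecessor {k} {x} eq with subst (λ l → Reach l x) eq (proj₁ (proj₂ (distance x)))
  ... | y , a , ρ = y , a , ≤-antisym (dist-least ρ) (s≤s⁻¹ (subst (_≤ suc (dist y)) eq (dist-adj a)))

  -- Following predecessors, every vertex after `x` is strictly closer to `r` than `z` is, so `z` is
  -- never met.
  detour-to-root : ∀ {z} k {x} → dist x ≡ k → x ≢ z → k ≤ dist z → Detour z x r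
  detour-to-root zero {x} eq x≢z _
    with refl ← subst (λ l → Reach l x) eq (proj₁ (proj₂ (distance x))) = stop x≢z
  detour-to-root (suc k) {x} eq x≢z k<dz with predecessor eq
  ... | y , a , eq' = go x≢z (adj-symmetric a) (detour-to-root k eq' (λ { refl → n≮n k (subst (k <_) eq' k<dz) }) (<⇒≤ k<dz))

  -- Two such neighbours would be joined through `r` by a walk avoiding `z`, hence lie on a cycle.
  -- Allowing equal distances also rules out edges inside one level.
  lower-neighbour-unique : ∀ {z x y} → Adj G z x → Adj G z y → dist x ≤ dist z → dist y ≤ dist z → x ≡ y
  lower-neighbour-unique {z} {x} {y} zx zy dx dy with x Fin.≟ y
  ... | yes eq = eq
  ... | no x≢y = contradiction
    (detour⇒cycle x≢y zx (adj-symmetric zy)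
      (detour-trans (detour-to-root _ refl (distinct zx) dx)
        (detour-sym adj-symmetric (detour-to-root _ refl (distinct zy) dy))))
    (proj₂ (proj₂ (proj₂ tree)))
    where
    distinct : ∀ {w} → Adj G z w → w ≢ z
    distinct a refl = adj-irreflexive a

  -- The distance is a separate argument, so that one can split on it without abstracting over
  -- `dist x`.
  parentOf : ∀ x k → dist x ≡ k → Fin n
  parentOf x zero    _  = r
  parentOf x (suc k) eq = proj₁ (predecessor {x = x} eq)

  lower⇒parent : ∀ {x y} k (eq : dist y ≡ k) → Adj G x y → dist x ≤ dist y →
    parentOf y k eq ≡ x × dist y ≡ suc (dist x)
  lower⇒parent {x} {y} zero eq a dx = contradiction
    (subst₂ (Adj G) (at-root (n≤0⇒n≡0 (subst (dist x ≤_) eq dx))) (at-root eq) a) adj-irreflexive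
    where
    at-root : ∀ {w} → dist w ≡ 0 → w ≡ r
    at-root {w} e = subst (λ l → Reach l w) e (proj₁ (proj₂ (distance w)))
  lower⇒parent {x} {y} (suc k) eq a dx = w≡x , trans eq (cong suc (trans (sym dw) (cong dist w≡x)))
    where
    w  = proj₁ (predecessor {x = y} eq)
    b  = proj₁ (proj₂ (predecessor {x = y} eq))
    dw = proj₂ (proj₂ (predecessor {x = y} eq))
    w≡x : w ≡ x
    w≡x = lower-neighbour-unique (adj-symmetric b) (adj-symmetric a)
      (≤-trans (≤-reflexive dw) (≤-trans (n≤1+n k) (≤-reflexive (sym eq)))) dx

  rooted : Rooted G r
  rooted = record
    { parent       = parent
    ; depth        = dist
    ; adj⇒child    = adj⇒child
    ; child⇒adj    = child⇒adj
    ; adj-sym      = adj-symmetric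
    ; parent-child = λ {y} {k} eq → refl , parent-child _ _ refl eq
    ; depth-root   = n≤0⇒n≡0 (dist-least refl)
    ; depth-zero   = λ {x} eq → subst (λ l → Reach l x) eq (proj₁ (proj₂ (distance x)))
    }
    where
    parent : Fin n → Fin n
    parent x = parentOf x (dist x) refl

    adj⇒child : ∀ {x y} → Adj G x y →
      (parent y ≡ x × dist y ≡ suc (dist x)) ⊎ (parent x ≡ y × dist x ≡ suc (dist y))
    adj⇒child {x} {y} a with ≤-total (dist x) (dist y)
    ... | inj₁ le = inj₁ (lower⇒parent _ refl a le)
    ... | inj₂ le = inj₂ (lower⇒parent _ refl (adj-symmetric a) le)

    child⇒adj : ∀ {x y} → parent y ≡ x × dist y ≡ suc (dist x) → Adj G x y
    child⇒adj {x} {y} (refl , eq) = adj-parent _ refl eq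
      where
      adj-parent : ∀ k (e : dist y ≡ k) → ∀ {l} → dist y ≡ suc l → Adj G (parentOf y k e) y
      adj-parent zero    e e' with () ← trans (sym e) e'
      adj-parent (suc k) e e' = proj₁ (proj₂ (predecessor {x = y} e))

    parent-child : ∀ y k (e : dist y ≡ k) → ∀ {l} → dist y ≡ suc l → dist y ≡ suc (dist (parentOf y k e))
    parent-child y zero    e e' with () ← trans (sym e) e'
    parent-child y (suc k) e e' = trans e (cong suc (sym (proj₂ (proj₂ (predecessor {x = y} e)))))

-- The tree with the head vertex added

module Extension {n : ℕ} (G : Graph n) (r : Fin n) (R : Rooted G r) where
  open Rooted R

  extend-parent : Fin (suc n) → Fin (suc n)
  extend-parent zero    = zero
  extend-parent (suc x) with depth x
  ... | zero  = zero
  ... | suc _ = suc (parent x)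

  extend-depth : Fin (suc n) → ℕ
  extend-depth zero    = 0
  extend-depth (suc x) = suc (depth x)

  extended : Rooted (extend G r) zero
  extended = record
    { parent       = extend-parent
    ; depth        = extend-depth
    ; adj⇒child    = λ {x} {y} → adj-cases x y
    ; child⇒adj    = λ {x} {y} → child-adj x y
    ; adj-sym      = λ {x} {y} → symmetric x y
    ; parent-child = λ {y} eq → refl , depth-parent y eq
    ; depth-root   = refl
    ; depth-zero   = λ { {zero} _ → refl }
    }
    where
    Childᵉ : Fin (suc n) → Fin (suc n) → Set
    Childᵉ x y = extend-parent y ≡ x × extend-depth y ≡ suc (extend-depth x)

    root-child : ∀ {j} → does (j Fin.≟ r) ≡ true → Childᵉ zero (suc j)
    root-child {j} a with j Fin.≟ r
    ... | yes refl rewrite depth-root = refl , refl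

    suc-child : ∀ {x y} → Child x y → Childᵉ (suc x) (suc y)
    suc-child {x} {y} (eq , d) rewrite d = cong suc eq , refl

    adj-cases : ∀ x y → Adj (extend G r) x y → Childᵉ x y ⊎ Childᵉ y x
    adj-cases zero    (suc y) a = inj₁ (root-child a)
    adj-cases (suc x) zero    a = inj₂ (root-child a)
    adj-cases (suc x) (suc y) a with adj⇒child a
    ... | inj₁ c = inj₁ (suc-child c)
    ... | inj₂ c = inj₂ (suc-child c)

    child-adj : ∀ x y → Childᵉ x y → Adj (extend G r) x y
    child-adj x zero (_ , ())
    child-adj zero (suc y) (_ , d) = dec-true (y Fin.≟ r) (depth-zero (suc-injective d))
    child-adj (suc x) (suc y) (eq , d) with depth y in dy
    ... | suc k = child⇒adj (Fin.suc-injective eq , trans dy (suc-injective d))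

    symmetric : ∀ x y → Adj (extend G r) x y → Adj (extend G r) y x
    symmetric zero    (suc y) a = a
    symmetric (suc x) zero    a = a
    symmetric (suc x) (suc y) a = adj-sym a

    depth-parent : ∀ y {k} → extend-depth y ≡ suc k → extend-depth y ≡ suc (extend-depth (extend-parent y))
    depth-parent (suc y) _ with depth y in dy
    ... | zero  = refl
    ... | suc k = cong suc (trans (sym dy) (proj₂ (parent-child dy)))

-- Subtree sizes and the top-down relabelling

module _ {A : Set} {P Q R : A → Set} (P? : Decidable P) (Q? : Decidable Q) (R? : Decidable R) where

  length-filter-disjoint : (∀ {x} → P x → R x) → (∀ {x} → Q x → R x) → (∀ {x} → P x → ¬ Q x) →
    ∀ xs → length (filter P? xs) + length (filter Q? xs) ≤ length (filter R? xs)
  length-filter-disjoint P⇒R Q⇒R P∩Q=∅ = count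
    where
    count : ∀ xs → length (filter P? xs) + length (filter Q? xs) ≤ length (filter R? xs)
    count [] = z≤n
    count (x ∷ xs) with P? x | Q? x | R? x
    ... | yes Px | yes Qx | _      = contradiction Qx (P∩Q=∅ Px)
    ... | yes Px | no _   | no ¬Rx = contradiction (P⇒R Px) ¬Rx
    ... | no _   | yes Qx | no ¬Rx = contradiction (Q⇒R Qx) ¬Rx
    ... | yes _  | no _   | yes _  = s≤s (count xs)
    ... | no _   | yes _  | yes _  = ≤-trans (≤-reflexive (+-suc _ _)) (s≤s (count xs))
    ... | no _   | no _   | yes _  = m≤n⇒m≤1+n (count xs)
    ... | no _   | no _   | no _   = count xs

module Descendants {N : ℕ} {G : Graph N} {root : Fin N} (R : Rooted G root) where
  open Rooted R

  ancestor : ℕ → Fin N → Fin N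
  ancestor zero    y = y
  ancestor (suc k) y = parent (ancestor k y)

  -- Descent is read off from the ancestor of `y` at the depth of `x`. This is decidable and makes
  -- the subtrees of siblings disjoint at once.
  Below : Fin N → Fin N → Set
  Below x y = depth x ≤ depth y × ancestor (depth y ∸ depth x) y ≡ x

  below? : ∀ x y → Dec (Below x y)
  below? x y = (depth x ≤? depth y) ×-dec (ancestor (depth y ∸ depth x) y Fin.≟ x)

  below-refl : ∀ x → Below x x
  below-refl x = ≤-refl , cong (λ k → ancestor k x) (n∸n≡0 (depth x))

  below-child : ∀ {x c y} → Child x c → Below c y → Below x y
  below-child {x} {c} {y} (refl , dc) (c≤y , anc) = <⇒≤ x<y
    , trans (cong (λ k → ancestor k y) (+-∸-assoc 1 x<y))
      (cong parent (trans (cong (λ d → ancestor (depth y ∸ d) y) (sym dc)) anc))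
    where
    x<y : depth x < depth y
    x<y = subst (_≤ depth y) dc c≤y

  below-siblings : ∀ {x c d y} → Child x c → Child x d → Below c y → Below d y → c ≡ d
  below-siblings {y = y} (_ , dc) (_ , dd) (_ , ac) (_ , ad) =
    trans (sym ac) (trans (cong (λ k → ancestor (depth y ∸ k) y) (trans dc (sym dd))) ad)

  size : Fin N → ℕ
  size x = length (filter (below? x) (allFin N))

  size≤ : ∀ x → size x ≤ N
  size≤ x = ≤-trans (length-filter (below? x) (allFin N)) (≤-reflexive (length-tabulate id))

  size-positive : ∀ x → 1 ≤ size x
  size-positive x = filter-some (below? x) (lose (∈-allFin x) (below-refl x))

  children-size : ∀ {x M} cs → Unique cs → All (Child x) cs → All (λ c → M ≤ size c) cs →
    length cs * M ≤ length (filter (λ y → any? (λ c → below? c y) cs) (allFin N))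
  children-size [] _ _ _ = z≤n
  children-size (c ∷ cs) (c∉ ∷ u) (child ∷ children) (M≤ ∷ M≤s) = ≤-trans
    (+-mono-≤ M≤ (children-size cs u children M≤s))
    (length-filter-disjoint (below? c) (λ y → any? (λ d → below? d y) cs) _
      here there
      (λ b bs → All.All¬⇒¬Any (All.zipWith
        (λ { (c≢d , child′) b′ → c≢d (below-siblings child child′ b b′) }) (c∉ , children)) bs)
      (allFin N))

  size-children : ∀ {x M} cs → Unique cs → All (Child x) cs → All (λ c → M ≤ size c) cs →
    length cs * M ≤ size x
  size-children {x} cs u children M≤ = ≤-trans (children-size cs u children M≤)
    -- Pairing with the empty predicate turns the count of disjoint sets into monotonicity of the
    -- count.
    (≤-trans (m≤m+n _ (length (filter (λ _ → no id) (allFin N))))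
      (length-filter-disjoint (λ y → any? (λ d → below? d y) cs) (λ _ → no id) (below? x)
        (λ bs → belowAny children bs) (λ ()) (λ _ ()) (allFin N)))
    where
    belowAny : ∀ {ds y} → All (Child x) ds → Any (λ d → Below d y) ds → Below x y
    belowAny (child ∷ _)  (here b)   = below-child child b
    belowAny (_ ∷ children) (there bs) = belowAny children bs

  size-mono : ∀ {x c} → Child x c → size c ≤ size x
  size-mono {x} {c} child = ≤-trans (m≤m+n (size c) 0)
    (size-children (c ∷ []) ([] ∷ []) (child ∷ []) (≤-refl ∷ []))

positive⇒suc : ∀ {n} → 0 < n → n ≡ suc (pred n)
positive⇒suc {suc n} _ = refl

zero⊎suc : ∀ n → n ≡ 0 ⊎ ∃[ d ] n ≡ suc d
zero⊎suc zero    = inj₁ refl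
zero⊎suc (suc d) = inj₂ (d , refl)

-- The least j ≤ J with s < m ^ j, provided s < m ^ J.
level : ℕ → ℕ → ℕ → ℕ
level m zero    s = 0
level m (suc J) s with s <? m ^ J
... | yes _ = level m J s
... | no _  = suc J

level≤ : ∀ m J s → level m J s ≤ J
level≤ m zero    s = z≤n
level≤ m (suc J) s with s <? m ^ J
... | yes _ = m≤n⇒m≤1+n (level≤ m J s)
... | no _  = ≤-refl

<^level : ∀ m J s → s < m ^ J → s < m ^ level m J s
<^level m zero    s s< = s<
<^level m (suc J) s s< with s <? m ^ J
... | yes s<′ = <^level m J s s<′
... | no _    = s<

level-suc : ∀ m J s {i} → level m J s ≡ suc i → m ^ i ≤ s
level-suc m (suc J) s eq with s <? m ^ J
... | yes _ = level-suc m J s eq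
level-suc m (suc J) s refl | no ¬s< = ≮⇒≥ ¬s<

level-mono : ∀ m .{{_ : NonZero m}} J {s t} → s ≤ t → t < m ^ J → level m J s ≤ level m J t
level-mono m J {s} {t} s≤t t< with level m J s in eq
... | zero  = z≤n
... | suc i = ≰⇒> λ lt≤i → <⇒≱ (<^level m J t t<)
      (≤-trans (^-monoʳ-≤ m lt≤i) (≤-trans (level-suc m J s eq) s≤t))

-- Relabelling from the root downwards

module TopDown (p lam m J : ℕ) .{{_ : NonZero m}} {N : ℕ} {G : Graph N} {root : Fin N}
  (R : Rooted G root) (N<m^J : N < m ^ J) where
  open Rooted R
  open Descendants R
  open Relabelling p lam

  rank : Fin N → ℕ
  rank x = level m J (size x)

  size<^J : ∀ x → size x < m ^ J
  size<^J x = ≤-<-trans (size≤ x) N<m^J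

  rank-child : ∀ {x c} → Child x c → rank c ≤ rank x
  rank-child {x} child = level-mono m J (size-mono child) (size<^J x)

  rank-suc : ∀ x → ∃[ i ] rank x ≡ suc i
  rank-suc x with rank x in eq
  ... | suc i = i , refl
  ... | zero  = contradiction (size-positive x)
    (<⇒≱ (subst (λ i → size x < m ^ i) eq (<^level m J (size x) (size<^J x))))

  heavy? : ∀ x c → Dec (Child x c × rank c ≡ rank x)
  heavy? x c = ((parent c Fin.≟ x) ×-dec (depth c ≟ suc (depth x))) ×-dec (rank c ≟ rank x)

  heavy : Fin N → List (Fin N)
  heavy x = filter (heavy? x) (allFin N)

  heavy-all : ∀ x → All (λ c → Child x c × rank c ≡ rank x) (heavy x)
  heavy-all x = All.all-filter (heavy? x) (allFin N)

  -- If `x` has rank `i + 1`, its heavy children have disjoint subtrees of at least `m ^ i` vertices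
  -- each, inside a subtree of fewer than `m ^ (i + 1)`.
  length-heavy : ∀ x → length (heavy x) ≤ m
  length-heavy x with rank-suc x
  ... | i , eq = <⇒≤ (*-cancelʳ-< (m ^ i) (length (heavy x)) m (begin-strict
    length (heavy x) * m ^ i  ≤⟨ size-children (heavy x) (Unique.filter⁺ (heavy? x) (Unique.allFin⁺ N))
                                   (All.map proj₁ (heavy-all x))
                                   (All.map (λ {c} (_ , eq′) → level-suc m J (size c) (trans eq′ eq)) (heavy-all x)) ⟩
    size x                    <⟨ subst (λ j → size x < m ^ j) eq (<^level m J (size x) (size<^J x)) ⟩
    m * m ^ i                 ∎))
    where open ≤-Reasoning

  module _ (spread : (threshold J + p) + (1 + (p + p) + m) + (threshold J + p) ≤ lam)
           (f : Fin N → ℕ) (labeling : IsLabeling p lam G f) where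

    f≤lam : ∀ x → f x ≤ lam
    f≤lam = proj₁ labeling

    child-far : ∀ {x c} → Child x c → Far p (f x) (f c)
    child-far child = distance⇒far _ _ (proj₁ (proj₂ labeling) _ _ (child⇒adj child))

    grandchild-dist2 : ∀ {x y z} → Child x y → Child y z → Dist2 G z x
    grandchild-dist2 {x} {y} {z} xy@(_ , dy) yz@(_ , dz) =
        (λ { refl → m≢1+n+m (depth z) {1} dz′ })
      , Bool.¬-not (λ a → nonadjacent (adj⇒child a))
      , y , adj-sym (child⇒adj yz) , adj-sym (child⇒adj xy)
      where
      dz′ : depth z ≡ 2 + depth x
      dz′ = trans dz (cong suc dy)
      nonadjacent : ¬ (Child z x ⊎ Child x z)
      nonadjacent (inj₁ (_ , dx)) = m≢1+n+m (depth x) {2} (trans dx (cong suc dz′))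
      nonadjacent (inj₂ (_ , d))  = m≢1+n+m (depth x) {0} (suc-injective (trans (sym d) dz′))

    child-allowed : ∀ {x c d} → depth x ≡ suc d → Child x c → Allowed (f (parent x)) (f x) (f c)
    child-allowed dx child = far-sym (child-far child)
      , proj₂ (proj₂ labeling) _ _ (grandchild-dist2 (parent-child dx) child)

    -- The invariant of the descent: `a` and `b` are the new labels of the parent of `x` and of `x`,
    -- and both changes are as deep as the rank of `x` requires.
    Relocation : Fin N → ℕ → ℕ → Set
    Relocation x a b = Move (threshold (rank x)) (f (parent x)) a × Move (threshold (rank x)) (f x) b × Far p a b

    relocation? : ∀ x a b → Dec (Relocation x a b)
    relocation? x a b = move? _ _ _ ×-dec (move? _ _ _ ×-dec far? p a b)

    record Plan (x : Fin N) (a b : ℕ) (σ : ℕ → ℕ) : Set where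
      field
        injective : ∀ {c d} → σ c ≡ σ d → c ≡ d
        allowed   : ∀ {c} → Allowed (f (parent x)) (f x) c → Allowed a b (σ c)
        moves     : ∀ {c} → Child x c → Move (threshold (rank c)) (f c) (σ (f c))

    plan : ∀ {x d a b} → depth x ≡ suc d → Relocation x a b → ∃[ σ ] Plan x a b σ
    plan {x} {d} {a} {b} dx (ma , mb , fab) with rank-suc x
    -- With `s` equal to `threshold i + p`, the depth `k` is `threshold (suc i)`. Heavy children get
    -- moves at `k`; the others have rank at most `i`, where depth `s` already suffices.
    ... | i , eq with redistribute {threshold i + p} (f (parent x)) (f x) a b
                        (subst (λ j → Move (threshold j) (f (parent x)) a) eq ma)
                        (subst (λ j → Move (threshold j) (f x) b) eq mb)
                        (child-far (parent-child dx)) fab m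
                        (≤-trans (+-mono-≤ (+-monoˡ-≤ _ k≤) k≤) spread)
                        (map f (heavy x))
                        (All.map⁺ (All.map (child-allowed dx ∘ proj₁) (heavy-all x)))
                        (≤-trans (≤-reflexive (length-map f (heavy x))) (length-heavy x))
      where
      k≤ : threshold i + p + p + p ≤ threshold J + p
      k≤ = +-monoˡ-≤ p (threshold-mono {suc i} {J} (subst (_≤ J) eq (level≤ m J (size x))))
    ... | σ , adj , heavies = σ , record
      { injective = Adjust.injective adj
      ; allowed   = Adjust.allowed adj
      ; moves     = moves }
      where
      moves : ∀ {c} → Child x c → Move (threshold (rank c)) (f c) (σ (f c))
      moves {c} child with rank c ≟ rank x
      ... | yes same = subst (λ j → Move (threshold j) (f c) (σ (f c))) (sym (trans same eq))
            (All.lookup heavies (∈-map⁺ f (∈-filter⁺ (heavy? x) (∈-allFin c) (child , same))))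
      ... | no differ = move-anti
            (threshold-mono (s≤s⁻¹ (subst (rank c <_) eq (≤∧≢⇒< (rank-child child) differ))))
            (within⇒move (Adjust.within adj (f c)))

    plan? : ∀ x a b → Dec (0 < depth x × Relocation x a b)
    plan? x a b = (0 <? depth x) ×-dec relocation? x a b

    -- Made total by the default `id`, so that labels can be defined before the invariant is proved.
    -- It depends only on `x`, `a` and `b`, so all children of `x` share one injection.
    permutation : Fin N → ℕ → ℕ → ℕ → ℕ
    permutation x a b with plan? x a b
    ... | yes (d> , r) = proj₁ (plan {x} (positive⇒suc d>) r)
    ... | no _         = id

    permutation-plan : ∀ {x d a b} → depth x ≡ suc d → Relocation x a b → Plan x a b (permutation x a b)
    permutation-plan {x} {d} {a} {b} dx r with plan? x a b
    ... | yes (d> , r′) = proj₂ (plan {x} (positive⇒suc d>) r′)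
    ... | no ¬r         = contradiction (subst (0 <_) (sym dx) z<s , r) ¬r

    module _ (v : Fin N) (depth-one : ∀ {x} → depth x ≡ 1 → x ≡ v) (a b : ℕ)
             (ma : Move (threshold J) (f root) a) (mb : Move (threshold J) (f v) b) (fab : Far p a b) where

      -- The depth is carried as an index to make the recursion structural, as `parent` is an
      -- arbitrary function.
      relabelAt : ℕ → Fin N → ℕ
      relabelAt zero          x = a
      relabelAt (suc zero)    x = b
      relabelAt (suc (suc d)) x =
        permutation (parent x) (relabelAt d (parent (parent x))) (relabelAt (suc d) (parent x)) (f x)

      relabel : Fin N → ℕ
      relabel x = relabelAt (depth x) x

      parent-depth : ∀ {x d} → depth x ≡ suc d → depth (parent x) ≡ d
      parent-depth dx = suc-injective (trans (sym (proj₂ (parent-child dx))) dx)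

      relabelAt-relocation : ∀ d {x} → depth x ≡ suc d →
        Relocation x (relabelAt d (parent x)) (relabelAt (suc d) x)
      relabelAt-relocation zero {x} dx
        with refl ← depth-one dx | eq ← depth-zero (parent-depth dx) =
          subst (λ y → Move (threshold (rank x)) (f y) a) (sym eq) (move-anti J≥ ma) , move-anti J≥ mb , fab
        where
        J≥ : threshold (rank x) ≤ threshold J
        J≥ = threshold-mono (level≤ m J (size x))
      relabelAt-relocation (suc d) {x} dx = move-anti (threshold-mono (rank-child child)) mb′
          , moves child , far-sym (proj₁ (allowed (child-allowed dp child)))
        where
        child = parent-child dx
        dp = parent-depth dx
        ih = relabelAt-relocation d dp
        mb′ = proj₁ (proj₂ ih)
        open Plan (permutation-plan dp ih)

      relabel-far : ∀ {x c} → Child x c → Far p (relabel x) (relabel c)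
      relabel-far {x} {c} (refl , dc) = subst (λ k → Far p (relabel x) (relabelAt k c)) (sym dc)
        (proj₂ (proj₂ (relabelAt-relocation (depth x) dc)))

      relabel-grandchild : ∀ {x y z} → Child x y → Child y z → relabel z ≢ relabel x
      relabel-grandchild {x} {y} {z} xy@(refl , dy) yz@(refl , dz) =
        subst (λ k → relabelAt k z ≢ relabel x) (sym dz′)
          (proj₂ (allowed (child-allowed dy yz)))
        where
        dz′ : depth z ≡ 2 + depth x
        dz′ = trans dz (cong suc dy)
        open Plan (permutation-plan dy (relabelAt-relocation (depth x) dy))

      relabel-sibling : ∀ {x y z} → Child x y → Child x z → Dist2 G y z → relabel y ≢ relabel z
      relabel-sibling {x} {y} {z} (py , dy) (pz , dz) far₂ eq with zero⊎suc (depth x)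
      -- No permutation acts at the root, but `v` is its only child.
      ... | inj₁ dx = proj₁ far₂ (trans (depth-one (trans dy (cong suc dx))) (sym (depth-one (trans dz (cong suc dx)))))
      ... | inj₂ (d , dx) = proj₂ (proj₂ labeling) y z far₂ (injective
              (trans (sym (at (trans dy (cong suc dx)) py)) (trans eq (at (trans dz (cong suc dx)) pz))))
        where
        open Plan (permutation-plan dx (relabelAt-relocation d dx))
        at : ∀ {w} → depth w ≡ suc (suc d) → parent w ≡ x →
          relabel w ≡ permutation x (relabelAt d (parent x)) (relabelAt (suc d) x) (f w)
        at {w} dw refl = cong (λ k → relabelAt k w) dw

      relabel-bound : a ≤ lam → ∀ x → relabel x ≤ lam
      relabel-bound a≤ x with zero⊎suc (depth x)
      ... | inj₁ dx = subst (λ k → relabelAt k x ≤ lam) (sym dx) a≤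
      ... | inj₂ (d , dx) = subst (λ k → relabelAt k x ≤ lam) (sym dx) (move-bound (f≤lam x) (proj₁ (proj₂ (relabelAt-relocation d dx))))

      relabel-labeling : a ≤ lam → IsLabeling p lam G relabel
      relabel-labeling a≤ = relabel-bound a≤ , adjacent , second
        where
        adjacent : ∀ x y → Adj G x y → p ≤ ∣ relabel x - relabel y ∣
        adjacent x y xy with adj⇒child xy
        ... | inj₁ c = far⇒distance _ _ (relabel-far c)
        ... | inj₂ c = far⇒distance _ _ (far-sym (relabel-far c))

        second : ∀ x y → Dist2 G x y → relabel x ≢ relabel y
        second x y far₂@(x≢y , _ , z , xz , zy) with adj⇒child xz | adj⇒child zy
        ... | inj₁ c        | inj₁ d        = relabel-grandchild c d ∘ sym
        ... | inj₁ (px , _) | inj₂ (pz , _) = contradiction (trans (sym px) pz) x≢y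
        ... | inj₂ c        | inj₁ d        = relabel-sibling c d far₂
        ... | inj₂ c        | inj₂ d        = relabel-grandchild d c

-- Arithmetic of the bound

1+n≤2^n : ∀ n → suc n ≤ 2 ^ n
1+n≤2^n zero    = ≤-refl
1+n≤2^n (suc n) = begin
  suc (suc n)      ≤⟨ +-mono-≤ (s≤s (z≤n {n})) (1+n≤2^n n) ⟩
  suc n + 2 ^ n    ≤⟨ +-mono-≤ (1+n≤2^n n) (≤-reflexive (sym (+-identityʳ (2 ^ n)))) ⟩
  2 ^ suc n        ∎
  where open ≤-Reasoning

^-distribʳ-* : ∀ o m n → (m * n) ^ o ≡ m ^ o * n ^ o
^-distribʳ-* zero    m n = refl
^-distribʳ-* (suc o) m n =
  trans (cong (m * n *_) (^-distribʳ-* o m n)) ([m*n]*[o*p]≡[m*o]*[n*p] m n (m ^ o) (n ^ o))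

m<[1+m/n]*n : ∀ m n .{{_ : NonZero n}} → m < suc (m / n) * n
m<[1+m/n]*n m n = ≤-trans (s≤s (≤-reflexive (m≡m%n+[m/n]*n m n))) (+-monoˡ-≤ (m / n * n) (m%n<n m n))

-- With `q = lam / Δ`, `lam` is below `(q + 1) * Δ`. Here `(q + 1) ^ Δ ≤ 2 ^ (q * Δ) ≤ n ^ lam`, and
-- `Δ ^ Δ ≤ n ^ lam`.
^-bound : ∀ {lam Δ n} → 1 ≤ Δ → Δ ≤ lam → Δ ≤ n → 2 ≤ n → lam ^ Δ ≤ n ^ (lam + lam)
^-bound {lam} {Δ@(suc _)} {n@(suc _)} _ Δ≤lam Δ≤n 2≤n = begin
  lam ^ Δ                ≤⟨ ^-monoˡ-≤ Δ (<⇒≤ (m<[1+m/n]*n lam Δ)) ⟩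
  (suc q * Δ) ^ Δ        ≡⟨ ^-distribʳ-* Δ (suc q) Δ ⟩
  suc q ^ Δ * Δ ^ Δ      ≤⟨ *-mono-≤ (^-monoˡ-≤ Δ (≤-trans (1+n≤2^n q) (^-monoˡ-≤ q 2≤n))) (^-monoˡ-≤ Δ Δ≤n) ⟩
  (n ^ q) ^ Δ * n ^ Δ    ≡⟨ cong (_* n ^ Δ) (^-*-assoc n q Δ) ⟩
  n ^ (q * Δ) * n ^ Δ    ≤⟨ *-mono-≤ (^-monoʳ-≤ n (m/n*n≤m lam Δ)) (^-monoʳ-≤ n Δ≤lam) ⟩
  n ^ lam * n ^ lam      ≡⟨ ^-distribˡ-+-* n lam lam ⟨
  n ^ (lam + lam)        ∎
  where
  open ≤-Reasoning
  q = lam / Δ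

-- The lower bound on `lam` leaves room for `m` fresh labels; the upper one gives `lam ≤ m * m`
-- because `3 ≤ m`.
2+2m≤lam≤3+2m : ∀ lam → 8 ≤ lam → ∃[ m ] (3 ≤ m × 2 + 2 * m ≤ lam × lam ≤ 3 + 2 * m)
2+2m≤lam≤3+2m (suc zero) (s≤s ())
2+2m≤lam≤3+2m lam@(suc (suc l)) 8≤lam with l / 2 | l % 2 | m≡m%n+[m/n]*n l 2 | m%n<n l 2
... | m | ρ | eq | ρ<2 = m , ≮⇒≥ small , lower , upper
  where
  upper : lam ≤ 3 + 2 * m
  upper = s≤s (s≤s (subst (_≤ 1 + 2 * m) (sym eq) (+-mono-≤ (s≤s⁻¹ ρ<2) (≤-reflexive (*-comm m 2)))))
  lower : 2 + 2 * m ≤ lam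
  lower = s≤s (s≤s (subst (2 * m ≤_) (sym eq) (≤-trans (≤-reflexive (*-comm 2 m)) (m≤n+m (m * 2) ρ))))
  small : ¬ m < 3
  small m<3 = <⇒≱ (≤-<-trans upper (s≤s (+-monoʳ-≤ 3 (*-monoʳ-≤ 2 (s≤s⁻¹ m<3))))) 8≤lam

double≤square : ∀ {n} → 2 ≤ n → n + n ≤ n * n
double≤square {n} 2≤n = ≤-trans (≤-reflexive (cong (n +_) (sym (+-identityʳ n)))) (*-monoˡ-≤ n 2≤n)

3+2m≤m*m : ∀ {m} → 3 ≤ m → 3 + 2 * m ≤ m * m
3+2m≤m*m {m} 3≤m = ≤-trans (+-monoˡ-≤ (2 * m) 3≤m) (*-monoˡ-≤ m 3≤m)

^-square : ∀ m k → (m * m) ^ k ≡ m ^ (2 * k)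
^-square m k = trans (cong (_^ k) (cong (m *_) (sym (*-identityʳ m)))) (^-*-assoc m 2 k)

-- For 16 p < lam the branching m ≈ lam / 2 is attained q ≈ (h + 1) / (16 p) times.
level-bound : ∀ {n Δ p lam h} → 2 ≤ n → 1 ≤ Δ → Δ ≤ n → 1 ≤ p →
  Δ + p ≤ lam + 1 → lam + 2 ≤ Δ + 2 * p → lam + 2 ≤ 2 * Δ + p → h + p ≤ lam →
  (∀ J m → 1 ≤ m → let t = Relabelling.threshold p lam J in
     (t + p) + (1 + (p + p) + m) + (t + p) ≤ lam → t + p ≤ h → m ^ J ≤ suc n) →
  BoundedBy 128 Δ p lam n (suc h)
level-bound {n@(suc _)} {Δ} {p@(suc _)} {lam} {h} 2≤n 1≤Δ Δ≤n 1≤p Δ+p≤ lam≤₁ lam≤₂ h+p≤lam branching =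
  ≤-trans h<2Δ (*-monoˡ-≤ Δ (m≤m+n 2 126)) , power
  where
  open ≤-Reasoning

  h<2Δ : suc h ≤ 2 * Δ
  h<2Δ = by-combination 1 (+-mono-≤ h+p≤lam lam≤₂) (i Δ h p lam)
    where
    i : ∀ Δ h p lam → 2 * Δ + (h + p + (lam + 2)) ≡ suc h + (lam + (2 * Δ + p)) + 1
    i = solve-∀

  h<lam : suc h ≤ lam
  h<lam = ≤-trans (≤-trans (≤-reflexive (+-comm 1 h)) (+-monoʳ-≤ h 1≤p)) h+p≤lam

  Δ≤lam : Δ ≤ lam
  Δ≤lam = by-combination 0 (+-mono-≤ Δ+p≤ 1≤p) (i Δ p lam)
    where
    i : ∀ Δ p lam → lam + (Δ + p + 1) ≡ Δ + (lam + 1 + p) + 0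
    i = solve-∀

  instance
    lam≢0 : NonZero lam
    lam≢0 = >-nonZero (≤-trans 1≤Δ Δ≤lam)
    16p≢0 : NonZero (16 * p)
    16p≢0 = m*n≢0 16 p

  small-lam : lam ≤ 16 * p → lam ^ suc h ≤ n ^ (128 * p)
  small-lam lam≤ = begin
    lam ^ suc h              ≤⟨ ^-monoʳ-≤ lam h<2Δ ⟩
    lam ^ (2 * Δ)            ≡⟨ cong (lam ^_) (*-comm 2 Δ) ⟩
    lam ^ (Δ * 2)            ≡⟨ ^-*-assoc lam Δ 2 ⟨
    (lam ^ Δ) ^ 2            ≤⟨ ^-monoˡ-≤ 2 (^-bound 1≤Δ Δ≤lam Δ≤n 2≤n) ⟩
    (n ^ (lam + lam)) ^ 2    ≡⟨ ^-*-assoc n (lam + lam) 2 ⟩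
    n ^ ((lam + lam) * 2)    ≤⟨ ^-monoʳ-≤ n exponent ⟩
    n ^ (128 * p)            ∎
    where
    i : ∀ lam p → 128 * p + 4 * lam ≡ (lam + lam) * 2 + 4 * (16 * p) + 64 * p
    i = solve-∀
    exponent : (lam + lam) * 2 ≤ 128 * p
    exponent = by-combination (64 * p) (*-monoʳ-≤ 4 lam≤) (i lam p)

  module _ (16p<lam : 16 * p < lam) where

    q = suc h / (16 * p)

    8≤lam : 8 ≤ lam
    8≤lam = ≤-trans (≤-trans (m≤m+n 8 8) (*-monoʳ-≤ 16 1≤p)) (<⇒≤ 16p<lam)

    lam≤n² : lam ≤ n * n
    lam≤n² = begin
      -- Eight times `lam + 2 ≤ Δ + 2 * p`, together with `16 * p < lam`, gives `7 * lam < 8 * Δ`.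
      lam    ≤⟨ *-cancelˡ-≤ 7 (by-combination (17 + 6 * Δ) (+-mono-≤ (*-monoʳ-≤ 8 lam≤₁) 16p<lam) (i lam Δ p)) ⟩
      Δ + Δ  ≤⟨ +-mono-≤ Δ≤n Δ≤n ⟩
      n + n  ≤⟨ double≤square 2≤n ⟩
      n * n  ∎
      where
      i : ∀ lam Δ p → 7 * (Δ + Δ) + (8 * (lam + 2) + suc (16 * p)) ≡ 7 * lam + (8 * (Δ + 2 * p) + lam) + (17 + 6 * Δ)
      i = solve-∀

    h<16p[1+q] : suc h ≤ suc q * (16 * p)
    h<16p[1+q] = <⇒≤ (m<[1+m/n]*n (suc h) (16 * p))

    large-lam : ∀ j → j ≡ q → lam ^ suc h ≤ n ^ (128 * p)
    large-lam zero eq = begin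
      -- For `q = 0` the exponent is at most `16 * p`, and `lam ≤ n * n` alone is enough.
      lam ^ suc h          ≤⟨ ^-monoʳ-≤ lam (subst (λ j → suc h ≤ suc j * (16 * p)) (sym eq) h<16p[1+q]) ⟩
      lam ^ (1 * (16 * p)) ≤⟨ ^-monoˡ-≤ (1 * (16 * p)) lam≤n² ⟩
      (n * n) ^ (1 * (16 * p)) ≡⟨ ^-square n (1 * (16 * p)) ⟩
      n ^ (2 * (1 * (16 * p))) ≤⟨ ^-monoʳ-≤ n (≤-trans (m≤m+n _ (96 * p)) (≤-reflexive (i p))) ⟩
      n ^ (128 * p)        ∎
      where
      i : ∀ p → 2 * (1 * (16 * p)) + 96 * p ≡ 128 * p
      i = solve-∀
    large-lam (suc j) eq with 2+2m≤lam≤3+2m lam 8≤lam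
    -- The 16 doubles three times to 128: by `q + 1 ≤ 2 * q`, by `lam ≤ m * m`, and by
    -- `n + 1 ≤ n * n`.
    ... | m , 3≤m , 2+2m≤lam , lam≤3+2m = begin
      lam ^ suc h                ≤⟨ ^-monoʳ-≤ lam (≤-trans h<16p[1+q] (≤-reflexive (cong (λ j → suc j * (16 * p)) (sym eq)))) ⟩
      lam ^ ((2 + j) * (16 * p)) ≤⟨ ^-monoʳ-≤ lam (≤-trans (m≤m+n _ (j * (16 * p))) (≤-reflexive (i₁ j p))) ⟩
      lam ^ (suc j * (32 * p))   ≤⟨ ^-monoˡ-≤ (suc j * (32 * p)) (≤-trans lam≤3+2m (3+2m≤m*m 3≤m)) ⟩
      (m * m) ^ (suc j * (32 * p))   ≡⟨ ^-square m (suc j * (32 * p)) ⟩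
      m ^ (2 * (suc j * (32 * p)))   ≡⟨ cong (m ^_) (i₂ (suc j) p) ⟩
      m ^ (suc j * (64 * p))     ≡⟨ ^-*-assoc m (suc j) (64 * p) ⟨
      (m ^ suc j) ^ (64 * p)     ≤⟨ ^-monoˡ-≤ (64 * p) (branching (suc j) m (≤-trans (m≤m+n 1 2) 3≤m) spread deep) ⟩
      suc n ^ (64 * p)           ≤⟨ ^-monoˡ-≤ (64 * p) (≤-trans (+-monoˡ-≤ n (≤-trans (m≤m+n 1 1) 2≤n)) (double≤square 2≤n)) ⟩
      (n * n) ^ (64 * p)         ≡⟨ ^-square n (64 * p) ⟩
      n ^ (2 * (64 * p))         ≡⟨ cong (n ^_) (i₃ p) ⟩
      n ^ (128 * p)              ∎
      where
      open Relabelling p lam using (threshold)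

      threshold-linear : ∀ i → threshold i ≡ 2 * (i * p)
      threshold-linear zero    = refl
      threshold-linear (suc i) = trans (cong (λ t → t + p + p) (threshold-linear i)) (i₀ i p)
        where
        i₀ : ∀ i p → 2 * (i * p) + p + p ≡ 2 * (suc i * p)
        i₀ = solve-∀

      i₁ : ∀ j p → (2 + j) * (16 * p) + j * (16 * p) ≡ suc j * (32 * p)
      i₁ = solve-∀
      i₂ : ∀ j p → 2 * (j * (32 * p)) ≡ j * (64 * p)
      i₂ = solve-∀
      i₃ : ∀ p → 2 * (64 * p) ≡ 128 * p
      i₃ = solve-∀

      16pq≤ : suc j * (16 * p) ≤ suc h
      16pq≤ = ≤-trans (≤-reflexive (cong (_* (16 * p)) eq)) (m/n*n≤m (suc h) (16 * p))

      deep : threshold (suc j) + p ≤ h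
      deep = subst (λ t → t + p ≤ h) (sym (threshold-linear (suc j)))
        (by-combination (14 * (j * p) + 12 * p) (+-mono-≤ 16pq≤ 1≤p) (k j p h))
        where
        k : ∀ j p h → h + (suc j * (16 * p) + 1) ≡ 2 * (suc j * p) + p + (suc h + p) + (14 * (j * p) + 12 * p)
        k = solve-∀

      spread : (threshold (suc j) + p) + (1 + (p + p) + m) + (threshold (suc j) + p) ≤ lam
      spread = subst (λ t → (t + p) + (1 + (p + p) + m) + (t + p) ≤ lam) (sym (threshold-linear (suc j)))
        -- After doubling, one `lam` covers `8 * p * q + 8 * p ≤ 16 * p * q` and the other covers
        -- `2 + 2 * m`.
        (*-cancelˡ-≤ 2 (by-combination (8 * (j * p)) (+-mono-≤ (≤-trans 16pq≤ h<lam) 2+2m≤lam) (k j p m lam)))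
        where
        k : ∀ j p m lam → 2 * lam + (suc j * (16 * p) + (2 + 2 * m))
          ≡ 2 * ((2 * (suc j * p) + p) + (1 + (p + p) + m) + (2 * (suc j * p) + p)) + (lam + lam) + 8 * (j * p)
        k = solve-∀

  power : lam ^ suc h ≤ n ^ (128 * p)
  power with lam ≤? 16 * p
  ... | yes lam≤ = small-lam lam≤
  ... | no lam≰  = large-lam (≰⇒> lam≰) _ refl

-- Compatibility and levels

degree≤ : ∀ {n} (G : Graph n) x → degree G x ≤ n
degree≤ {n} G x = ≤-trans (bounded (allFin n)) (≤-reflexive (length-tabulate id))
  where
  bounded : ∀ ys → sum (map (λ y → if G x y then 1 else 0) ys) ≤ length ys
  bounded []       = z≤n
  bounded (y ∷ ys) with G x y
  ... | true  = s≤s (bounded ys)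
  ... | false = m≤n⇒m≤1+n (bounded ys)

maxDegree≤ : ∀ {n} (G : Graph n) → maxDegree G ≤ n
maxDegree≤ {n} G = bounded (allFin n)
  where
  bounded : ∀ xs → foldr _⊔_ 0 (map (degree G) xs) ≤ n
  bounded []       = z≤n
  bounded (x ∷ xs) = ⊔-lub (degree≤ G x) (bounded xs)

positive-maxDegree : ∀ {n} (G : Graph n) → (∀ x → G x x ≡ false) → 1 ≤ maxDegree G → 2 ≤ n
positive-maxDegree {suc (suc n)} G _ _ = s≤s (s≤s z≤n)
positive-maxDegree {suc zero} G irreflexive pos with G zero zero | irreflexive zero
positive-maxDegree {suc zero} G irreflexive () | .false | refl

module Levels {n : ℕ} (T : Graph n) (r : Fin n) (p lam : ℕ) (tree : IsTree T) where
  open Relabelling p lam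

  module Tᵉ = Rooted (Extension.extended T r (BreadthFirst.rooted T r tree))

  depth-one : ∀ {x} → Tᵉ.depth x ≡ 1 → x ≡ suc r
  depth-one {suc x} d = cong suc (Rooted.depth-zero (BreadthFirst.rooted T r tree) (suc-injective d))

  depth-neck : Tᵉ.depth (suc r) ≡ 1
  depth-neck = cong suc (Rooted.depth-root (BreadthFirst.rooted T r tree))

  module _ (J m : ℕ) (1≤m : 1 ≤ m) (n<m^J : suc n < m ^ J)
           (spread : (threshold J + p) + (1 + (p + p) + m) + (threshold J + p) ≤ lam) where

    -- The extended tree is rooted at the new vertex, so its labels at depths 0 and 1 are those of
    -- the edge (u,v). Head and neck changes are the cases in which one of the two moves is trivial.
    transfer : ∀ {a b a' b'} → Move (threshold J) a a' → Move (threshold J) b b' →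
      Far p a' b' → a' ≤ lam → Delta p lam T r a b → Delta p lam T r a' b'
    transfer {a' = a'} {b'} ma mb fab a'≤ (f , labeling , refl , refl) =
      relabel spread f labeling (suc r) depth-one a' b' ma mb fab
      , relabel-labeling spread f labeling (suc r) depth-one a' b' ma mb fab a'≤
      , refl
      , cong (λ k → relabelAt spread f labeling (suc r) depth-one a' b' ma mb fab k (suc r)) depth-neck
      where
      instance
        m≢0 : NonZero m
        m≢0 = >-nonZero 1≤m
      open TopDown p lam m J (Extension.extended T r (BreadthFirst.rooted T r tree)) n<m^J

    module _ {h : ℕ} (deep : threshold J + p ≤ h) where

      inL⇒move : ∀ {x x'} → InL lam h x → InL lam h x' → Move (threshold J) x x'
      inL⇒move q q' = inj₂ (inL-anti (≤-trans (m≤m+n _ p) deep) q , inL-anti deep q')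

      headCompat : HeadCompat p lam T r h
      headCompat a a' b a∈ a'∈ b∈ ab a'b =
          transfer (inL⇒move a∈ a'∈) (inj₁ refl) (distance⇒far a' b a'b) (m+n≤o⇒m≤o a' (proj₂ a'∈))
        , transfer (inL⇒move a'∈ a∈) (inj₁ refl) (distance⇒far a b ab) (m+n≤o⇒m≤o a (proj₂ a∈))

      neckCompat : NeckCompat p lam T r h
      neckCompat a b b' a∈ b∈ b'∈ ab ab' =
          transfer (inj₁ refl) (inL⇒move b∈ b'∈) (distance⇒far a b' ab') (m+n≤o⇒m≤o a (proj₂ a∈))
        , transfer (inj₁ refl) (inL⇒move b'∈ b∈) (distance⇒far a b ab) (m+n≤o⇒m≤o a (proj₂ a∈))

  -- A label of `L_h` has fewer than `p` labels on either side here. Hence compatibility is vacuous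
  -- for such `h`, and a failure at `h` forces `h + p ≤ lam`.
  no-far-label : ∀ {h x y} → lam < h + p → InL lam h x → y ≤ lam → ¬ Far p x y
  no-far-label {h} {x} lam< (h≤x , _) y≤ (inj₁ q) = <⇒≱ lam< (≤-trans (+-monoˡ-≤ p h≤x) (≤-trans q y≤))
  no-far-label {h} {x} {y} lam< (_ , x+h≤) y≤ (inj₂ q) = <⇒≱ lam< (begin
    h + p      ≤⟨ m≤n+m (h + p) y ⟩
    y + (h + p) ≡⟨ i h p y ⟩
    y + p + h  ≤⟨ +-monoˡ-≤ h q ⟩
    x + h      ≤⟨ x+h≤ ⟩
    lam        ∎)
    where
    open ≤-Reasoning
    i : ∀ h p y → y + (h + p) ≡ y + p + h
    i = solve-∀

  headCompat-vacuous : ∀ {h} → lam < h + p → HeadCompat p lam T r h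
  headCompat-vacuous lam< a a' b a∈ _ b∈ ab _ =
    contradiction (distance⇒far a b ab) (no-far-label lam< a∈ (m+n≤o⇒m≤o b (proj₂ b∈)))

  neckCompat-vacuous : ∀ {h} → lam < h + p → NeckCompat p lam T r h
  neckCompat-vacuous lam< a b b' a∈ b∈ _ ab _ =
    contradiction (far-sym (distance⇒far a b ab)) (no-far-label lam< b∈ (m+n≤o⇒m≤o a (proj₂ a∈)))

  module _ {Δ : ℕ} (Δ≡ : Δ ≡ maxDegree T) (1≤p : 1 ≤ p)
           (lam≥ : Δ + p ≤ lam + 1) (lam≤₁ : lam + 2 ≤ Δ + 2 * p) (lam≤₂ : lam + 2 ≤ 2 * Δ + p) where

    Δ≤n : Δ ≤ n
    Δ≤n = subst (_≤ n) (sym Δ≡) (maxDegree≤ T)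

    1≤Δ : 1 ≤ Δ
    1≤Δ = by-combination 0 (+-mono-≤ lam≥ lam≤₂) (i Δ p lam)
      where
      i : ∀ Δ p lam → Δ + (Δ + p + (lam + 2)) ≡ 1 + (lam + 1 + (2 * Δ + p)) + 0
      i = solve-∀

    2≤n : 2 ≤ n
    2≤n = positive-maxDegree T (proj₁ (proj₂ tree)) (subst (1 ≤_) Δ≡ 1≤Δ)

    level-zero-bound : BoundedBy 128 Δ p lam n 0
    level-zero-bound = z≤n , m^n>0 n (128 * p)
      where
      instance
        n≢0 : NonZero n
        n≢0 = >-nonZero (<⇒≤ 2≤n)

    -- Failure at `h` reverses each sufficient condition: for all `m` and `J` that fit into the
    -- label range and below depth `h`, the extended tree has at least `m ^ J` vertices.
    incompatible-bound : ∀ {P : Set} {h} → (lam < h + p → P) →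
      (∀ J m → 1 ≤ m → suc n < m ^ J →
        (threshold J + p) + (1 + (p + p) + m) + (threshold J + p) ≤ lam → threshold J + p ≤ h → P) →
      ¬ P → BoundedBy 128 Δ p lam n (suc h)
    incompatible-bound vacuous compat ¬P =
      level-bound 2≤n 1≤Δ Δ≤n 1≤p lam≥ lam≤₁ lam≤₂ (≮⇒≥ (¬P ∘ vacuous))
        (λ J m 1≤m spread deep → ≮⇒≥ λ n<m^J → ¬P (compat J m 1≤m n<m^J spread deep))

    headLevel-bound : ∀ h → IsHeadLevel p lam T r h → BoundedBy 128 Δ p lam n h
    headLevel-bound zero    _        = level-zero-bound
    headLevel-bound (suc h) (¬hc , _) = incompatible-bound headCompat-vacuous
      (λ J m 1≤m n< spread deep → headCompat J m 1≤m n< spread deep) ¬hc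

    neckLevel-bound : ∀ h → IsNeckLevel p lam T r h → BoundedBy 128 Δ p lam n h
    neckLevel-bound zero    _        = level-zero-bound
    neckLevel-bound (suc h) (¬nc , _) = incompatible-bound neckCompat-vacuous
      (λ J m 1≤m n< spread deep → neckCompat J m 1≤m n< spread deep) ¬nc

theorem5p3 : ∃[ C ] (∀ (n : ℕ) (T : Graph n) (r : Fin n) (Δ p lam : ℕ) →
    IsTree T → Δ ≡ maxDegree T → 1 ≤ p →
    Δ + p ≤ lam + 1 → lam + 2 ≤ Δ + 2 * p → lam + 2 ≤ 2 * Δ + p →
    (∀ h → IsHeadLevel p lam T r h → BoundedBy C Δ p lam n h)
    × (∀ h → IsNeckLevel p lam T r h → BoundedBy C Δ p lam n h))
theorem5p3 = 128 , λ n T r Δ p lam tree Δ≡ 1≤p lam≥ lam≤₁ lam≤₂ →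
  let open Levels T r p lam tree
  in headLevel-bound Δ≡ 1≤p lam≥ lam≤₁ lam≤₂ , neckLevel-bound Δ≡ 1≤p lam≥ lam≤₁ lam≤₂
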